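{- There exist positive constants $c_1,c_2$ such that for all positive integers $n$ and $S$ for which $M(n,S)$ is nonempty, $$c_1\le\frac{\max M(n,S)}{\max M_4(n,S)}\le c_2,$$ i.e. $\max M(n,S)\asymp\max M_4(n,S)$ with implied constants independent of $n$ and $S$.
   Context: The continuant $\langle a_1,\ldots,a_n\rangle$ is defined by $\langle\,\rangle=1$, $\langle a_1\rangle=a_1$, $\langle a_1,\ldots,a_n\rangle=a_n\langle a_1,\ldots,a_{n-1}\rangle+\langle a_1,\ldots,a_{n-2}\rangle$. For a sequence $A=(a_1,\ldots,a_n)$ of positive integers let $S^{\varphi}_n(A)=\sum_{i=1}^n a_i(\frac32+\frac12(-1)^i)=a_1+2a_2+a_3+2a_4+\cdots$. $M(n,S)$ is the set of sequences of positive integers of length $n$ with $S^{\varphi}_n(A)=S$, and $\max M(n,S)$ denotes the maximum of $\langle A\rangle$ over $A\in M(n,S)$. $M_4(n,S)\subseteq M(n,S)$ is the set of those $A$ for which there exist positive integers $a,b$ with $a_i\in\{a,a+1\}$ for all odd $i$ and $a_i\in\{b,b+1\}$ for all even $i$; $\max M_4(n,S)$ is the maximum of $\langle A\rangle$ over this set. -}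

module Defs where

open import Data.Nat.Base using (ℕ; zero; suc; _+_; _*_; _≤_; _<_; parity)
open import Data.Fin.Base using (Fin; toℕ)
open import Data.Parity.Base using (Parity; 0ℙ; 1ℙ)
open import Data.Product.Base using (∃-syntax; _×_)
open import Data.Sum.Base using (_⊎_)
open import Data.Vec.Base using (Vec; init; last; lookup; sum; tabulate)
open import Data.Vec.Relation.Unary.All using (All)
open import Level using (0ℓ)
open import Relation.Binary.PropositionalEquality using (_≡_)
open import Relation.Unary using (Pred)

continuant : ∀ {n} → Vec ℕ n → ℕ
continuant {zero}        A = 1
continuant {suc zero}    A = last A
continuant {suc (suc n)} A =
  last A * continuant (init A) + continuant (init (init A))

-- Sequences are indexed from 1, so position i of a vector is the index
-- suc (toℕ i).
indexParity : ∀ {n} → Fin n → Parity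
indexParity i = parity (suc (toℕ i))

-- 3/2 + (-1)^i/2 as a function of the parity of i.
weight : Parity → ℕ
weight 0ℙ = 2
weight 1ℙ = 1

Sφ : ∀ {n} → Vec ℕ n → ℕ
Sφ A = sum (tabulate λ i → lookup A i * weight (indexParity i))

M : (n S : ℕ) → Pred (Vec ℕ n) 0ℓ
M n S A = All (0 <_) A × Sφ A ≡ S

M₄ : (n S : ℕ) → Pred (Vec ℕ n) 0ℓ
M₄ n S A = M n S A × ∃[ a ] ∃[ b ] (0 < a × 0 < b
  × (∀ i → indexParity i ≡ 1ℙ → lookup A i ≡ a ⊎ lookup A i ≡ suc a)
  × (∀ i → indexParity i ≡ 0ℙ → lookup A i ≡ b ⊎ lookup A i ≡ suc b))

IsMaxContinuant : ∀ {n} → Pred (Vec ℕ n) 0ℓ → ℕ → Set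
IsMaxContinuant P m =
  (∃[ A ] (P A × continuant A ≡ m)) × (∀ A → P A → continuant A ≤ m)

{-# OPTIONS --safe #-}
module Submission where

-- Pin a 2 to both ends of A. Since 4⟨A⟩ ≤ ⟨2,A,2⟩ ≤ 9⟨A⟩, it suffices that every A in
-- M(n,S) maximising ⟨2,A,2⟩ lies in M₄(n,S). For letters x and y of the word,
-- ⟨P,x,Q,y,R⟩ / ⟨P⟩⟨Q⟩⟨R⟩ = (x + p + q)(y + q′ + r) + const, where p, q, q′, r are the
-- continued fractions [0; …] read off outwards from x and y. Maximality against moving
-- units from x to y gives linear inequalities between these fractions.
--
-- If x and y have the same parity, moving one unit gives x - 1 + p + q ≤ y + q′ + r, so
-- x ≤ y + 2, and x = y + 2 forces q′ or r above 1/2, hence a 1 next to y.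
--  · x, y even: trading one unit of x for two units of that 1 is profitable.
--  · x, y odd: trading two units of x for one unit of that 1 is profitable unless y ≤ 5.
--    As even letters differ by at most 1, they are at most 2, so that p and q are at least
--    1/3 if y = 1 and at least 2/5 otherwise, while q′ and r are at most
--    (y + 3)/(y + 4); this contradicts 1 + p + q ≤ q′ + r.
-- The value 2 of the pins satisfies every bound used here on letters of either parity.

open import Defs

module PinnedContinuant where

  open import Data.Empty using (⊥; ⊥-elim)
  open import Data.Fin.Base using (Fin; zero; suc; toℕ)
  open import Data.Fin.Properties using (all?; any?; toℕ<n)
  import Data.Integer.Base as ℤ
  import Data.Integer.Properties as ℤ
  open import Data.List.Base using (List; []; _∷_; _++_; [_]; _ʳ++_; reverse; length; filter; upTo; cartesianProductWith)
  open import Data.List.Membership.Propositional using (_∈_)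
  open import Data.List.Membership.Propositional.Properties using (∈-cartesianProductWith⁺; ∈-upTo⁺; ∈-filter⁺)
  open import Data.List.Properties using (++-assoc; length-++; reverse-involutive; unfold-reverse; ʳ++-defn)
  open import Data.List.Relation.Unary.All as All using (All; []; _∷_)
  open import Data.List.Relation.Unary.All.Properties using (++⁺; all-filter)
  open import Data.List.Relation.Binary.Permutation.Propositional using (↭-sym)
  open import Data.List.Relation.Binary.Permutation.Propositional.Properties using (All-resp-↭; ↭-reverse)
  open import Data.List.Relation.Unary.Any using (here)
  open import Data.Nat.Base
  open import Data.Nat.Properties
  open import Data.List.Extrema ≤-totalOrder using (argmax; argmax-all; f[xs]≤f[argmax])
  open import Data.Nat.Tactic.RingSolver using (solve-∀)
  open import Data.Parity.Base using (0ℙ; 1ℙ; _⁻¹)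
  import Data.Parity.Properties as ℙ
  open import Data.Product.Base using (∃-syntax; _×_; _,_; proj₁; proj₂)
  import Data.Rational.Base as ℚ
  import Data.Rational.Properties as ℚ
  open import Data.Rational.Unnormalised.Base as ℚᵘ using (mkℚᵘ; *≤*)
  import Data.Rational.Unnormalised.Properties as ℚᵘ
  open import Data.Sum.Base using (_⊎_; inj₁; inj₂)
  open import Data.Vec.Base using (Vec; []; _∷_; lookup; toList; fromList; tabulate; sum; init; last; initLast)
  open import Data.Vec.Properties using (toList∘fromList; toList-∷ʳ; tabulate-cong)
  open import Data.Vec.Relation.Unary.All as VAll using ([]; _∷_)
  open import Data.Vec.Relation.Unary.All.Properties using (toList⁺; toList⁻; lookup⁺)
  open import Function.Base using (_∘_)
  open import Level using (0ℓ)
  open import Relation.Binary.Definitions using (tri<; tri≈; tri>)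
  open import Relation.Binary.PropositionalEquality
    using (_≡_; _≢_; refl; sym; trans; cong; cong₂; subst; subst₂; module ≡-Reasoning)
  open import Relation.Nullary using (¬_; yes; no)
  open import Relation.Nullary.Decidable using (_×-dec_; _→-dec_; map′)
  open import Relation.Unary using (Pred; Decidable; Satisfiable)

  -- Continuants of lists and Euler's identity for cut words.

  -- `K⁻ l / K l` is the continued fraction [0; a₁, a₂, ...] of the letters of `l`; the value 0 at
  -- the empty list makes one recursion cover words of length 1.
  K K⁻ : List ℕ → ℕ
  K []      = 1
  K (a ∷ l) = a * K l + K⁻ l
  K⁻ []      = 0
  K⁻ (a ∷ l) = K l

  -- Euler's identity with both halves read outwards from the cut. Moving the cut past one letter
  -- leaves the right-hand side unchanged, and this is the induction step.
  K-ʳ++ : ∀ l m → K (l ʳ++ m) ≡ K l * K m + K⁻ l * K⁻ m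
  K-ʳ++ []      m = sym (trans (+-identityʳ _) (*-identityˡ (K m)))
  K-ʳ++ (a ∷ l) m =
    trans (K-ʳ++ l (a ∷ m)) (regroup a (K l) (K⁻ l) (K m) (K⁻ m))
    where
    regroup : ∀ a b c d e → b * (a * d + e) + c * d ≡ (a * b + c) * d + b * e
    regroup = solve-∀

  K-reverse : ∀ l → K (reverse l) ≡ K l
  K-reverse l = trans (K-ʳ++ l []) (simp (K l) (K⁻ l))
    where
    simp : ∀ a b → a * 1 + b * 0 ≡ a
    simp = solve-∀

  ++-as-ʳ++ : ∀ (l m : List ℕ) → l ++ m ≡ reverse l ʳ++ m
  ++-as-ʳ++ l m =
    sym (trans (ʳ++-defn (reverse l)) (cong (_++ m) (reverse-involutive l)))

  K-++ : ∀ l m → K (l ++ m) ≡ K l * K m + K⁻ (reverse l) * K⁻ m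
  K-++ l m = begin
    K (l ++ m)                                  ≡⟨ cong K (++-as-ʳ++ l m) ⟩
    K (reverse l ʳ++ m)                         ≡⟨ K-ʳ++ (reverse l) m ⟩
    K (reverse l) * K m + K⁻ (reverse l) * K⁻ m ≡⟨ cong (λ z → z * K m + K⁻ (reverse l) * K⁻ m) (K-reverse l) ⟩
    K l * K m + K⁻ (reverse l) * K⁻ m           ∎
    where open ≡-Reasoning

  -- The numbers `K l`, `K⁻ (reverse l)`, `K⁻ l`, δ are the entries of the product of the matrices
  -- (a 1; 1 0) over the letters of `l`; the empty word gives the identity matrix, hence δ = 1.
  K⁻-++ : ∀ l → ∃[ δ ] (∀ m → K⁻ (l ++ m) ≡ K⁻ l * K m + δ * K⁻ m)
  K⁻-++ []      = 1 , λ m → sym (+-identityʳ (K⁻ m))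
  K⁻-++ (a ∷ l) = K⁻ (reverse l) , K-++ l

  K-∷ʳ : ∀ l a → K (l ++ [ a ]) ≡ a * K l + K⁻ (reverse l)
  K-∷ʳ l a = trans (K-++ l [ a ]) (simp (K l) a (K⁻ (reverse l)))
    where
    simp : ∀ b a c → b * (a * 1 + 0) + c * 1 ≡ a * b + c
    simp = solve-∀

  toList-init-last : ∀ {n} (A : Vec ℕ (suc n)) → toList A ≡ toList (init A) ++ [ last A ]
  toList-init-last A with ys , y , eq ← initLast A = trans (cong toList eq) (toList-∷ʳ y ys)

  reverse-∷ʳ : ∀ (l : List ℕ) a → reverse (l ++ [ a ]) ≡ a ∷ reverse l
  reverse-∷ʳ l a = begin
    reverse (l ++ [ a ])                     ≡⟨ cong (λ z → reverse (z ++ [ a ])) (reverse-involutive l) ⟨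
    reverse (reverse (reverse l) ++ [ a ])   ≡⟨ cong reverse (unfold-reverse a (reverse l)) ⟨
    reverse (reverse (a ∷ reverse l))        ≡⟨ reverse-involutive (a ∷ reverse l) ⟩
    a ∷ reverse l                            ∎
    where open ≡-Reasoning

  -- `continuant` unfolds at the last letter and `K` at the first. `K-∷ʳ` reconciles them: `K⁻` of a
  -- reversed word is the continuant without the last letter.
  continuant≡K : ∀ {n} (A : Vec ℕ n) → continuant A ≡ K (toList A)
  continuant≡K {zero}  [] = refl
  continuant≡K {suc zero} (a ∷ []) = sym (trans (+-identityʳ _) (*-identityʳ a))
  continuant≡K {suc (suc n)} A = begin
    last A * continuant (init A) + continuant (init (init A))
      ≡⟨ cong₂ (λ y z → last A * y + z) (continuant≡K (init A)) (continuant≡K (init (init A))) ⟩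
    last A * K l + K l′
      ≡⟨ cong (last A * K l +_) (K-reverse l′) ⟨
    last A * K l + K⁻ (last (init A) ∷ reverse l′)
      ≡⟨ cong (λ z → last A * K l + K⁻ z) (trans (cong reverse (toList-init-last (init A))) (reverse-∷ʳ l′ _)) ⟨
    last A * K l + K⁻ (reverse l)
      ≡⟨ K-∷ʳ l (last A) ⟨
    K (l ++ [ last A ])
      ≡⟨ cong K (toList-init-last A) ⟨
    K (toList A) ∎
    where
    open ≡-Reasoning
    l  = toList (init A)
    l′ = toList (init (init A))

  K-pos : ∀ {l} → All (0 <_) l → 0 < K l
  K-pos []                   = s≤s z≤n
  K-pos {a ∷ l} (0<a ∷ ps) = ≤-trans (*-mono-≤ 0<a (K-pos ps)) (m≤m+n (a * K l) _)

  K⁻-pos : ∀ {a l} → All (0 <_) (a ∷ l) → 0 < K⁻ (a ∷ l)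
  K⁻-pos (_ ∷ ps) = K-pos ps

  K⁻≤K : ∀ {l} → All (0 <_) l → K⁻ l ≤ K l
  K⁻≤K []         = z≤n
  K⁻≤K {a ∷ l} (0<a ∷ _) =
    ≤-trans (≤-trans (≤-reflexive (sym (*-identityˡ (K l)))) (*-monoˡ-≤ (K l) 0<a)) (m≤m+n (a * K l) _)

  -- Words with two distinguished letters and the effect of exchanging units.

  -- The word p x q y r, read from its two distinguished letters: k, k⁻ belong to
  -- the reversal of p, the pair u, v to r, and α, β, γ, δ to the middle word q.
  F : (k k⁻ α β γ δ u v x y : ℕ) → ℕ
  F k k⁻ α β γ δ u v x y =
    (k * x + k⁻) * (α * (y * u + v) + β * u) + k * (γ * (y * u + v) + δ * u)

  -- Reading the word from the right transposes the matrix of the middle word, so β and γ trade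
  -- places.
  F-flip : ∀ k k⁻ α β γ δ u v x y → F k k⁻ α β γ δ u v x y ≡ F u v α γ β δ k k⁻ y x
  F-flip = expanded
    where
    expanded : ∀ k k⁻ α β γ δ u v x y →
      (k * x + k⁻) * (α * (y * u + v) + β * u) + k * (γ * (y * u + v) + δ * u)
      ≡ (u * y + v) * (α * (x * k + k⁻) + γ * k) + u * (β * (x * k + k⁻) + δ * k)
    expanded = solve-∀

  -- A single δ serves all x and y, so it cancels when two choices of these letters are compared.
  K-two-letters : ∀ p q r → ∃[ δ ] (∀ x y →
    K (p ʳ++ (x ∷ q ++ y ∷ r)) ≡ F (K p) (K⁻ p) (K q) (K⁻ (reverse q)) (K⁻ q) δ (K r) (K⁻ r) x y)
  K-two-letters p q r with δ , eq ← K⁻-++ q = δ , λ x y → begin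
    K (p ʳ++ (x ∷ q ++ y ∷ r))
      ≡⟨ K-ʳ++ p (x ∷ q ++ y ∷ r) ⟩
    K p * (x * K (q ++ y ∷ r) + K⁻ (q ++ y ∷ r)) + K⁻ p * K (q ++ y ∷ r)
      ≡⟨ cong₂ (λ a b → K p * (x * a + b) + K⁻ p * a) (K-++ q (y ∷ r)) (eq (y ∷ r)) ⟩
    K p * (x * (K q * K (y ∷ r) + K⁻ (reverse q) * K r) + (K⁻ q * K (y ∷ r) + δ * K r))
      + K⁻ p * (K q * K (y ∷ r) + K⁻ (reverse q) * K r)
      ≡⟨ regroup (K p) x (K q) (K⁻ (reverse q)) (K⁻ q) δ (K⁻ p) (K r) (K (y ∷ r)) ⟩
    F (K p) (K⁻ p) (K q) (K⁻ (reverse q)) (K⁻ q) δ (K r) (K⁻ r) x y ∎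
    where
    open ≡-Reasoning
    regroup : ∀ k x α β γ δ k⁻ u w → k * (x * (α * w + β * u) + (γ * w + δ * u)) + k⁻ * (α * w + β * u)
      ≡ (k * x + k⁻) * (α * w + β * u) + k * (γ * w + δ * u)
    regroup = solve-∀

  -- Dividing F x (y + c) ≤ F (x + d) y by k α u gives
  -- c (x + k⁻/k + γ/α) ≤ d (y + v/u + β/α); a, a′ and b, b′ bound the four
  -- fractions, over the common denominator D.
  exchange-bound : ∀ {k k⁻ α β γ δ u v x y} c d D {a a′ b b′} → 0 < k → 0 < α → 0 < u →
    F k k⁻ α β γ δ u v x (y + c) ≤ F k k⁻ α β γ δ u v (x + d) y →
    a * k ≤ D * k⁻ → a′ * α ≤ D * γ → D * v ≤ b * u → D * β ≤ b′ * α →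
    c * (D * x + a + a′) ≤ d * (D * y + b + b′)
  exchange-bound {k} {k⁻} {α} {β} {γ} {δ} {u} {v} {x} {y} c d D {a} {a′} {b} {b′}
    0<k 0<α 0<u F≤F ak≤ a′α≤ Dv≤ Dβ≤ =
    *-cancelˡ-≤ (k * α * u) {{>-nonZero (*-mono-≤ (*-mono-≤ 0<k 0<α) 0<u)}} (begin
      k * α * u * (c * (D * x + a + a′))
        ≡⟨ left k α u c D x a a′ ⟩
      c * u * (k * α * (D * x) + a * k * α + k * (a′ * α))
        ≤⟨ *-monoʳ-≤ (c * u) (+-mono-≤ (+-monoʳ-≤ (k * α * (D * x)) (*-monoˡ-≤ α ak≤)) (*-monoʳ-≤ k a′α≤)) ⟩
      c * u * (k * α * (D * x) + D * k⁻ * α + k * (D * γ))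
        ≡⟨ mid k α u c D x k⁻ γ ⟩
      D * (c * (u * (k * α * x + k * γ + k⁻ * α)))
        ≤⟨ *-monoʳ-≤ D divided ⟩
      D * (d * (k * (α * (y * u + v) + β * u)))
        ≡⟨ mid′ D d k α y u v β ⟩
      d * k * (α * (D * y) * u + α * (D * v) + D * β * u)
        ≤⟨ *-monoʳ-≤ (d * k) (+-mono-≤ (+-monoʳ-≤ (α * (D * y) * u) (*-monoʳ-≤ α Dv≤)) (*-monoˡ-≤ u Dβ≤)) ⟩
      d * k * (α * (D * y) * u + α * (b * u) + b′ * α * u)
        ≡⟨ right k α u d D y b b′ ⟩
      k * α * u * (d * (D * y + b + b′)) ∎)
    where
    open ≤-Reasoning
    left : ∀ k α u c D x a a′ →
      k * α * u * (c * (D * x + a + a′)) ≡ c * u * (k * α * (D * x) + a * k * α + k * (a′ * α))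
    left = solve-∀
    mid : ∀ k α u c D x k⁻ γ →
      c * u * (k * α * (D * x) + D * k⁻ * α + k * (D * γ)) ≡ D * (c * (u * (k * α * x + k * γ + k⁻ * α)))
    mid = solve-∀
    mid′ : ∀ D d k α y u v β →
      D * (d * (k * (α * (y * u + v) + β * u))) ≡ d * k * (α * (D * y) * u + α * (D * v) + D * β * u)
    mid′ = solve-∀
    right : ∀ k α u d D y b b′ →
      d * k * (α * (D * y) * u + α * (b * u) + b′ * α * u) ≡ k * α * u * (d * (D * y + b + b′))
    right = solve-∀
    raise-y : ∀ k k⁻ α β γ δ u v x y c → 
      (k * x + k⁻) * (α * ((y + c) * u + v) + β * u) + k * (γ * ((y + c) * u + v) + δ * u)
      ≡ ((k * x + k⁻) * (α * (y * u + v) + β * u) + k * (γ * (y * u + v) + δ * u)) + c * (u * (k * α * x + k * γ + k⁻ * α))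
    raise-y = solve-∀
    raise-x : ∀ k k⁻ α β γ δ u v x y d → 
      (k * (x + d) + k⁻) * (α * (y * u + v) + β * u) + k * (γ * (y * u + v) + δ * u)
      ≡ ((k * x + k⁻) * (α * (y * u + v) + β * u) + k * (γ * (y * u + v) + δ * u)) + d * (k * (α * (y * u + v) + β * u))
    raise-x = solve-∀
    -- Both words exceed `F … x y` by a term linear in c or d; subtracting this common value also
    -- removes δ.
    divided : c * (u * (k * α * x + k * γ + k⁻ * α)) ≤ d * (k * (α * (y * u + v) + β * u))
    divided = +-cancelˡ-≤ (F k k⁻ α β γ δ u v x y) _ _
      (subst₂ _≤_ (raise-y k k⁻ α β γ δ u v x y c) (raise-x k k⁻ α β γ δ u v x y d) F≤F)

  *-scaleˡ-≤ : ∀ {a b x y} m → a * x ≤ b * y → m * a * x ≤ m * b * y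
  *-scaleˡ-≤ {a} {b} {x} {y} m h =
    subst₂ _≤_ (sym (*-assoc m a x)) (sym (*-assoc m b y)) (*-monoʳ-≤ m h)

  -- Over the denominator k D the fraction k⁻/k has the exact numerator D k⁻. Keeping it, with 0 as
  -- lower bound for γ/α, makes the inequality strict because k⁻ > 0.
  exchange-bound-strict : ∀ {k k⁻ α β γ δ u v x y} c d D {b b′} → 0 < k → 0 < α → 0 < u →
    F k k⁻ α β γ δ u v x (y + c) ≤ F k k⁻ α β γ δ u v (x + d) y →
    0 < c → 0 < D → 0 < k⁻ → D * v ≤ b * u → D * β ≤ b′ * α →
    c * (D * x) < d * (D * y + b + b′)
  exchange-bound-strict {k} {k⁻} {α} {β} {γ} {δ} {u} {v} {x} {y} c d D {b} {b′}
    0<k 0<α 0<u F≤F 0<c 0<D 0<k⁻ Dv≤ Dβ≤ =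
    *-cancelˡ-< k _ _ (begin-strict
      k * (c * (D * x))                       ≡⟨ +-identityʳ _ ⟨
      k * (c * (D * x)) + 0                   <⟨ +-monoʳ-< _ (*-mono-≤ 0<c (*-mono-≤ 0<D 0<k⁻)) ⟩
      k * (c * (D * x)) + c * (D * k⁻)        ≡⟨ left k c D x k⁻ ⟩
      c * (k * D * x + D * k⁻ + 0)            ≤⟨ exchange-bound {k} {k⁻} {α} {β} {γ} {δ} {u} {v} {x} {y}
                                                  c d (k * D) {b = k * b} {k * b′} 0<k 0<α 0<u F≤F
                                                  (≤-reflexive (assoc D k⁻ k)) z≤n
                                                  (*-scaleˡ-≤ {D} {b} {v} {u} k Dv≤) (*-scaleˡ-≤ {D} {b′} {β} {α} k Dβ≤) ⟩
      d * (k * D * y + k * b + k * b′)        ≡⟨ right d k D y b b′ ⟩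
      k * (d * (D * y + b + b′))              ∎)
    where
    open ≤-Reasoning
    left : ∀ k c D x k⁻ → k * (c * (D * x)) + c * (D * k⁻) ≡ c * (k * D * x + D * k⁻ + 0)
    left = solve-∀
    right : ∀ d k D y b b′ → d * (k * D * y + k * b + k * b′) ≡ k * (d * (D * y + b + b′))
    right = solve-∀
    assoc : ∀ D k⁻ k → D * k⁻ * k ≡ k * D * k⁻
    assoc = solve-∀

  -- Segments of a word and weighted sums.

  -- Letters are given by a function of the position, so cutting a word is arithmetic on the start
  -- and the length of segments.
  up down : (ℕ → ℕ) → ℕ → ℕ → List ℕ
  up f k zero    = []
  up f k (suc m) = f k ∷ up f (suc k) m
  down f k zero    = []
  down f k (suc m) = f (k + m) ∷ down f k m

  length-up : ∀ f k m → length (up f k m) ≡ m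
  length-up f k zero    = refl
  length-up f k (suc m) = cong suc (length-up f (suc k) m)

  up-++ : ∀ f k m m′ → up f k (m + m′) ≡ up f k m ++ up f (k + m) m′
  up-++ f k zero    m′ = cong (λ z → up f z m′) (sym (+-identityʳ k))
  up-++ f k (suc m) m′ = cong (f k ∷_) (trans (up-++ f (suc k) m m′)
    (cong (λ z → up f (suc k) m ++ up f z m′) (sym (+-suc k m))))

  up-∷ʳ : ∀ f k m → up f k (suc m) ≡ up f k m ++ [ f (k + m) ]
  up-∷ʳ f k m = trans (cong (up f k) (sym (+-comm m 1))) (up-++ f k m 1)

  reverse-up : ∀ f k m → reverse (up f k m) ≡ down f k m
  reverse-up f k zero    = refl
  reverse-up f k (suc m) = begin
    reverse (up f k (suc m))            ≡⟨ cong reverse (up-∷ʳ f k m) ⟩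
    reverse (up f k m ++ [ f (k + m) ]) ≡⟨ reverse-∷ʳ (up f k m) _ ⟩
    f (k + m) ∷ reverse (up f k m)      ≡⟨ cong (f (k + m) ∷_) (reverse-up f k m) ⟩
    down f k (suc m)                    ∎
    where open ≡-Reasoning

  down-ʳ++ : ∀ f k m l → down f k m ʳ++ l ≡ up f k m ++ l
  down-ʳ++ f k m l = trans (cong (_ʳ++ l) (sym (reverse-up f k m))) (sym (++-as-ʳ++ (up f k m) l))

  wt : ℕ → ℕ
  wt k = weight (parity k)

  -- The absolute position `k` is carried along so that a factor keeps the weights it has in the
  -- whole word.
  wsum : ℕ → List ℕ → ℕ
  wsum k []      = 0
  wsum k (a ∷ l) = a * wt k + wsum (suc k) l

  wsum-++ : ∀ k l m → wsum k (l ++ m) ≡ wsum k l + wsum (k + length l) m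
  wsum-++ k []      m = cong (λ z → wsum z m) (sym (+-identityʳ k))
  wsum-++ k (a ∷ l) m = trans (cong (a * wt k +_) (trans (wsum-++ (suc k) l m)
      (cong (λ z → wsum (suc k) l + wsum z m) (sym (+-suc k (length l))))))
    (sym (+-assoc (a * wt k) _ _))

  parity-suc : ∀ k → parity (suc k) ≡ parity k ⁻¹
  parity-suc k = sym (ℙ.⁻¹-selfInverse (ℙ.suc-homo-⁻¹ k))

  parity-suc-cong : ∀ {k l} → parity k ≡ parity l → parity (suc k) ≡ parity (suc l)
  parity-suc-cong {k} {l} eq = trans (parity-suc k) (trans (cong _⁻¹ eq) (sym (parity-suc l)))

  parity-suc≢ : ∀ k → parity k ≢ parity (suc k)
  parity-suc≢ k eq = ℙ.p≢p⁻¹ _ (trans eq (parity-suc k))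

  0ℙ≢1ℙ : 0ℙ ≢ 1ℙ
  0ℙ≢1ℙ ()

  -- Exchanges in a word that maximises ⟨2,A,2⟩.

  -- Positions 0 and `suc n` of `W` hold the pins, which stay fixed; only the letters at positions 1
  -- to `n` compete with other words.
  module Exchange
    (n : ℕ) (W : ℕ → ℕ) (W-first : W 0 ≡ 2) (W-last : W (suc n) ≡ 2)
    (W-pos : ∀ {k} → 0 < k → k ≤ n → 0 < W k)
    (W-max : ∀ L → length L ≡ n → All (0 <_) L → wsum 1 L ≡ wsum 1 (up W 1 n) →
      K (2 ∷ L ++ [ 2 ]) ≤ K (2 ∷ up W 1 n ++ [ 2 ]))
    where

    Inner : ℕ → Set
    Inner k = 0 < k × k ≤ n

    -- A pin counts as a letter of either parity, so the bounds on letters need not track where the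
    -- word ends.
    Occurs : ℕ → ℕ → Set
    Occurs c w = w ≡ 2 ⊎ ∃[ a ] (Inner a × parity a ≡ parity c × W a ≡ w)

    -- Entries are alternately letters at positions of the parities of c, suc c.
    data Alternating : ℕ → List ℕ → Set where
      []  : ∀ {c} → Alternating c []
      _∷_ : ∀ {c w l} → Occurs c w → Alternating (suc c) l → Alternating c (w ∷ l)

    Occurs-pos : ∀ {c w} → Occurs c w → 0 < w
    Occurs-pos (inj₁ refl)                     = s≤s z≤n
    Occurs-pos (inj₂ (_ , (0<a , a≤n) , _ , refl)) = W-pos 0<a a≤n

    Alternating-pos : ∀ {c l} → Alternating c l → All (0 <_) l
    Alternating-pos []       = []
    Alternating-pos {c} (o ∷ os) = Occurs-pos {c} o ∷ Alternating-pos os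

    Alternating-cong : ∀ {c d l} → parity c ≡ parity d → Alternating c l → Alternating d l
    Alternating-cong eq []       = []
    Alternating-cong {c} {d} eq (o ∷ os) = Occurs-cong o ∷ Alternating-cong (parity-suc-cong {c} {d} eq) os
      where
      Occurs-cong : ∀ {w} → Occurs c w → Occurs d w
      Occurs-cong (inj₁ e)                 = inj₁ e
      Occurs-cong (inj₂ (a , ia , pa , e)) = inj₂ (a , ia , trans pa eq , e)

    occurs : ∀ k → k ≤ suc n → Occurs k (W k)
    occurs zero    _ = inj₁ W-first
    occurs (suc k) k≤ with m≤n⇒m<n∨m≡n k≤
    ... | inj₁ (s≤s k≤n) = inj₂ (suc k , (s≤s z≤n , k≤n) , refl , refl)
    ... | inj₂ refl      = inj₁ W-last

    up-Alternating : ∀ k m → k + m ≤ 2 + n → Alternating k (up W k m)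
    up-Alternating k zero    _ = []
    up-Alternating k (suc m) h =
      occurs k (s≤s⁻¹ (≤-trans (s≤s (m≤m+n k m)) h′)) ∷ up-Alternating (suc k) m h′
      where
      h′ : suc (k + m) ≤ 2 + n
      h′ = subst (_≤ 2 + n) (+-suc k m) h

    -- A step to the left changes the parity just as a step to the right does. Hence the index may
    -- grow along a word read backwards, and `suc (k + m)` has the parity of its first position k +
    -- m - 1.
    down-Alternating : ∀ k m → k + m ≤ 2 + n → Alternating (suc (k + m)) (down W k m)
    down-Alternating k zero    _ = []
    down-Alternating k (suc m) h rewrite +-suc k m =
      occurs (k + m) (s≤s⁻¹ h) ∷ Alternating-cong refl (down-Alternating k m (≤-trans (n≤1+n _) h))

    up⁻-pos : ∀ {c k m} → 0 < m → Alternating c (up W k m) → 0 < K⁻ (up W k m)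
    up⁻-pos {m = suc m} _ alt = K⁻-pos (Alternating-pos alt)

    down⁻-pos : ∀ {c k m} → 0 < m → Alternating c (down W k m) → 0 < K⁻ (down W k m)
    down⁻-pos {m = suc m} _ alt = K⁻-pos (Alternating-pos alt)

    -- An outer side with only one letter is the bare pin; this later excludes the word [1], whose
    -- fraction is 1.
    up-end : ∀ {e} k m → W (k + m) ≡ 2 → up W k (suc m) ≡ e ∷ [] → e ≡ 2
    up-end k zero eq refl = trans (cong W (sym (+-identityʳ k))) eq

    down-end : ∀ {e} m → down W 0 (suc m) ≡ e ∷ [] → e ≡ 2
    down-end zero refl = W-first

    -- The word read from its letters i and j: p and r are read outwards from
    -- i and j, q is read from i towards j and q′ from j towards i.
    record Sides (i j : ℕ) : Set where
      field
        p q q′ r : List ℕ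
        δ        : ℕ
        p-alt    : Alternating (suc i) p
        q-alt    : Alternating (suc i) q
        q′-alt   : Alternating (suc j) q′
        r-alt    : Alternating (suc j) r
        p⁻-pos   : 0 < K⁻ p
        -- Positions of equal parity are not adjacent, so the middle word is nonempty.
        q⁻-pos   : parity i ≡ parity j → 0 < K⁻ q
        r-end    : ∀ {e} → r ≡ e ∷ [] → e ≡ 2
        q-single : ∀ {e} → q′ ≡ e ∷ [] → q ≡ e ∷ []
        Kq≡Kq′   : K q ≡ K q′
        exchange : ∀ x y → 0 < x → 0 < y → W i * wt i + W j * wt j ≡ x * wt i + y * wt j →
          F (K p) (K⁻ p) (K q) (K⁻ q′) (K⁻ q) δ (K r) (K⁻ r) x y
          ≤ F (K p) (K⁻ p) (K q) (K⁻ q′) (K⁻ q) δ (K r) (K⁻ r) (W i) (W j)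

    -- The positions are encoded by three lengths: i′ letters before i, m between i and j, r′ after
    -- j. The outer words `p` and `r` each have one letter more, the pin.
    module Ordered (i′ m r′ : ℕ) (n≡ : i′ + suc (m + suc r′) ≡ n) where
      i j : ℕ
      i = suc i′
      j = suc i + m

      p q r : List ℕ
      p = down W 0 i
      q = up W (suc i) m
      r = up W (suc j) (suc r′)

      j+r≡ : suc j + r′ ≡ suc n
      j+r≡ = trans (shift i′ m r′) (cong suc n≡)
        where
        shift : ∀ i′ m r′ → suc (suc (suc i′) + m) + r′ ≡ suc (i′ + suc (m + suc r′))
        shift = solve-∀

      word : ℕ → ℕ → List ℕ
      word x y = up W 1 i′ ++ x ∷ q ++ y ∷ up W (suc j) r′

      up≡word : up W 1 n ≡ word (W i) (W j)
      up≡word = begin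
        up W 1 n                                 ≡⟨ cong (up W 1) n≡ ⟨
        up W 1 (i′ + suc (m + suc r′))           ≡⟨ up-++ W 1 i′ _ ⟩
        up W 1 i′ ++ W i ∷ up W (suc i) (m + suc r′) ≡⟨ cong (λ z → up W 1 i′ ++ W i ∷ z) (up-++ W (suc i) m (suc r′)) ⟩
        word (W i) (W j)                         ∎
        where open ≡-Reasoning

      length-word : ∀ x y → length (word x y) ≡ n
      length-word x y = begin
        length (word x y)
          ≡⟨ length-++ (up W 1 i′) ⟩
        length (up W 1 i′) + suc (length (q ++ y ∷ up W (suc j) r′))
          ≡⟨ cong₂ (λ a b → a + suc b) (length-up W 1 i′) (length-++ q) ⟩
        i′ + suc (length q + suc (length (up W (suc j) r′)))
          ≡⟨ cong₂ (λ a b → i′ + suc (a + suc b)) (length-up W (suc i) m) (length-up W (suc j) r′) ⟩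
        i′ + suc (m + suc r′)
          ≡⟨ n≡ ⟩
        n ∎
        where open ≡-Reasoning

      wsum-word : ∀ x y → wsum 1 (word x y) ≡
        wsum 1 (up W 1 i′) + (wsum (suc i) q + wsum (suc j) (up W (suc j) r′)) + (x * wt i + y * wt j)
      wsum-word x y = begin
        wsum 1 (word x y)
          ≡⟨ wsum-++ 1 (up W 1 i′) _ ⟩
        wsum 1 (up W 1 i′) + wsum (1 + length (up W 1 i′)) (x ∷ q ++ y ∷ up W (suc j) r′)
          ≡⟨ cong (λ z → wsum 1 (up W 1 i′) + wsum (suc z) (x ∷ q ++ y ∷ up W (suc j) r′)) (length-up W 1 i′) ⟩
        wsum 1 (up W 1 i′) + (x * wt i + wsum (suc i) (q ++ y ∷ up W (suc j) r′))
          ≡⟨ cong (λ z → wsum 1 (up W 1 i′) + (x * wt i + z)) (wsum-++ (suc i) q _) ⟩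
        wsum 1 (up W 1 i′) + (x * wt i + (wsum (suc i) q + wsum (suc i + length q) (y ∷ up W (suc j) r′)))
          ≡⟨ cong (λ z → wsum 1 (up W 1 i′) + (x * wt i + (wsum (suc i) q + wsum (suc i + z) (y ∷ up W (suc j) r′))))
               (length-up W (suc i) m) ⟩
        wsum 1 (up W 1 i′) + (x * wt i + (wsum (suc i) q + (y * wt j + wsum (suc j) (up W (suc j) r′))))
          ≡⟨ regroup (wsum 1 (up W 1 i′)) (x * wt i) (wsum (suc i) q) (y * wt j) _ ⟩
        _ ∎
        where
        open ≡-Reasoning
        regroup : ∀ a b c d e → a + (b + (c + (d + e))) ≡ a + (c + e) + (b + d)
        regroup = solve-∀

      pinned-word : ∀ x y → 2 ∷ word x y ++ [ 2 ] ≡ p ʳ++ (x ∷ q ++ y ∷ r)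
      pinned-word x y = begin
        2 ∷ word x y ++ [ 2 ]
          ≡⟨ cong₂ (λ a b → a ∷ word x y ++ [ b ]) (sym W-first) (sym (trans (cong W j+r≡) W-last)) ⟩
        W 0 ∷ word x y ++ [ z ]
          ≡⟨ cong (W 0 ∷_) (++-assoc (up W 1 i′) _ _) ⟩
        W 0 ∷ up W 1 i′ ++ x ∷ (q ++ y ∷ up W (suc j) r′) ++ [ z ]
          ≡⟨ cong (λ l → up W 0 i ++ x ∷ l) (++-assoc q _ _) ⟩
        up W 0 i ++ x ∷ q ++ y ∷ (up W (suc j) r′ ++ [ z ])
          ≡⟨ cong (λ l → up W 0 i ++ x ∷ q ++ y ∷ l) (up-∷ʳ W (suc j) r′) ⟨
        up W 0 i ++ x ∷ q ++ y ∷ r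
          ≡⟨ down-ʳ++ W 0 i _ ⟨
        p ʳ++ (x ∷ q ++ y ∷ r) ∎
        where
        open ≡-Reasoning
        z = W (suc j + r′)

      j≤2+n : j ≤ 2 + n
      j≤2+n = ≤-trans (m≤m+n j (suc r′)) (≤-trans (≤-reflexive (trans (+-suc j r′) j+r≡)) (n≤1+n _))

      i≤2+n : i ≤ 2 + n
      i≤2+n = ≤-trans (≤-trans (n≤1+n i) (m≤m+n (suc i) m)) j≤2+n

      p-alt : Alternating (suc i) p
      p-alt = down-Alternating 0 i i≤2+n

      q-alt : Alternating (suc i) q
      q-alt = up-Alternating (suc i) m j≤2+n

      q′-alt : Alternating (suc j) (reverse q)
      q′-alt = subst (Alternating (suc j)) (sym (reverse-up W (suc i) m))
        (down-Alternating (suc i) m j≤2+n)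

      r-alt : Alternating (suc j) r
      r-alt = up-Alternating (suc j) (suc r′) (≤-reflexive (trans (+-suc (suc j) r′) (cong suc j+r≡)))

      inner-pos : ∀ x y → 0 < x → 0 < y → All (0 <_) (word x y)
      inner-pos x y 0<x 0<y = ++⁺ (Alternating-pos (up-Alternating 1 i′ i≤2+n))
        (0<x ∷ ++⁺ (Alternating-pos q-alt) (0<y ∷ Alternating-pos (up-Alternating (suc j) r′ (≤-trans (≤-reflexive j+r≡) (n≤1+n _)))))

      δ : ℕ
      δ = proj₁ (K-two-letters p q r)

      K-word : ∀ x y → K (2 ∷ word x y ++ [ 2 ]) ≡
        F (K p) (K⁻ p) (K q) (K⁻ (reverse q)) (K⁻ q) δ (K r) (K⁻ r) x y
      K-word x y = trans (cong K (pinned-word x y)) (proj₂ (K-two-letters p q r) x y)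

      exchange : ∀ x y → 0 < x → 0 < y → W i * wt i + W j * wt j ≡ x * wt i + y * wt j →
        F (K p) (K⁻ p) (K q) (K⁻ (reverse q)) (K⁻ q) δ (K r) (K⁻ r) x y
        ≤ F (K p) (K⁻ p) (K q) (K⁻ (reverse q)) (K⁻ q) δ (K r) (K⁻ r) (W i) (W j)
      exchange x y 0<x 0<y eq = subst₂ _≤_ (K-word x y)
        (trans (cong (λ l → K (2 ∷ l ++ [ 2 ])) up≡word) (K-word (W i) (W j)))
        (W-max (word x y) (length-word x y) (inner-pos x y 0<x 0<y)
          (trans (wsum-word x y) (trans (cong (others +_) (sym eq))
            (sym (trans (cong (wsum 1) up≡word) (wsum-word (W i) (W j)))))))
        where
        others : ℕ
        others = wsum 1 (up W 1 i′) + (wsum (suc i) q + wsum (suc j) (up W (suc j) r′))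

      nonadjacent : parity i ≡ parity j → 0 < m
      nonadjacent eq = n≢0⇒n>0 λ m≡0 →
        parity-suc≢ i (trans eq (cong parity (trans (cong (suc i +_) m≡0) (+-identityʳ (suc i)))))

      q⁻-pos : parity i ≡ parity j → 0 < K⁻ q
      q⁻-pos eq = up⁻-pos (nonadjacent eq) q-alt

      q′⁻-pos : parity i ≡ parity j → 0 < K⁻ (reverse q)
      q′⁻-pos eq = subst (λ l → 0 < K⁻ l) (sym (reverse-up W (suc i) m))
        (down⁻-pos (nonadjacent eq) (subst (Alternating (suc j)) (reverse-up W (suc i) m) q′-alt))

      forward : Sides i j
      forward = record
        { p = p ; q = q ; q′ = reverse q ; r = r ; δ = δ
        ; p-alt = p-alt ; q-alt = q-alt ; q′-alt = q′-alt ; r-alt = r-alt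
        ; p⁻-pos = K⁻-pos (Alternating-pos p-alt)
        ; q⁻-pos = q⁻-pos
        ; r-end = up-end (suc j) r′ (trans (cong W j+r≡) W-last)
        ; q-single = λ eq → trans (sym (reverse-involutive q)) (cong reverse eq)
        ; Kq≡Kq′ = sym (K-reverse q)
        ; exchange = exchange
        }

      -- The same cut seen from j. With both directions available, later arguments need not know
      -- which of the two letters comes first.
      backward : Sides j i
      backward = record
        { p = r ; q = reverse q ; q′ = q ; r = p ; δ = δ
        ; p-alt = r-alt ; q-alt = q′-alt ; q′-alt = q-alt ; r-alt = p-alt
        ; p⁻-pos = K⁻-pos (Alternating-pos r-alt)
        ; q⁻-pos = λ eq → q′⁻-pos (sym eq)
        ; r-end = down-end i′
        ; q-single = λ eq → cong reverse eq
        ; Kq≡Kq′ = K-reverse q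
        ; exchange = λ x y 0<x 0<y eq → subst₂ _≤_ (flip y x) (flip (W i) (W j))
            (exchange y x 0<y 0<x (trans (+-comm (W i * wt i) _) (trans eq (+-comm (x * wt j) _))))
        }
        where
        flip : ∀ x y → F (K p) (K⁻ p) (K q) (K⁻ (reverse q)) (K⁻ q) δ (K r) (K⁻ r) x y
          ≡ F (K r) (K⁻ r) (K (reverse q)) (K⁻ q) (K⁻ (reverse q)) δ (K p) (K⁻ p) y x
        flip x y = trans (F-flip (K p) (K⁻ p) (K q) (K⁻ (reverse q)) (K⁻ q) δ (K r) (K⁻ r) x y)
          (cong (λ α → F (K r) (K⁻ r) α (K⁻ q) (K⁻ (reverse q)) δ (K p) (K⁻ p) y x) (sym (K-reverse q)))

    sides-< : ∀ {i j} → 0 < i → i < j → j ≤ n → Sides i j × Sides j i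
    sides-< {suc i′} _ i<j j≤n
      with m , refl ← m≤n⇒∃[o]m+o≡n i<j
      with r′ , eq ← m≤n⇒∃[o]m+o≡n j≤n
      = O.forward , O.backward
      where
      shift : ∀ i′ m r′ → i′ + suc (m + suc r′) ≡ suc (suc i′) + m + r′
      shift = solve-∀
      module O = Ordered i′ m r′ (trans (shift i′ m r′) eq)

    sides : ∀ {i j} → Inner i → Inner j → i ≢ j → Sides i j
    sides {i} {j} (0<i , i≤n) (0<j , j≤n) i≢j with <-cmp i j
    ... | tri< i<j _ _ = proj₁ (sides-< 0<i i<j j≤n)
    ... | tri≈ _ i≡j _ = ⊥-elim (i≢j i≡j)
    ... | tri> _ _ j<i = proj₂ (sides-< 0<j j<i i≤n)

    -- Bounds on continued fractions from their first two letters.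

    -- The fraction is at most 1/w for its first letter w, so only w = 1 can exceed 1/2. A pin is 2,
    -- hence such a letter sits at an inner position.
    tail≤1/2 : ∀ {c l} → Alternating c l →
      2 * K⁻ l ≤ 1 * K l ⊎ ∃[ a ] (Inner a × parity a ≡ parity c × W a ≡ 1)
    tail≤1/2 []                       = inj₁ z≤n
    tail≤1/2 (_∷_ {w = w} {l = l} o os) with 2 ≤? w
    ... | yes 2≤w = inj₁ (≤-trans (*-monoˡ-≤ (K l) 2≤w) (≤-trans (m≤m+n (w * K l) _) (≤-reflexive (sym (*-identityˡ _)))))
    tail≤1/2 {c} (inj₁ refl ∷ os)                     | no 2≰w = ⊥-elim (2≰w ≤-refl)
    tail≤1/2 {c} (inj₂ (a , ia , pa , refl) ∷ os)     | no 2≰w =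
      inj₂ (a , ia , pa , ≤-antisym (s≤s⁻¹ (≰⇒> 2≰w)) (W-pos (proj₁ ia) (proj₂ ia)))

    -- The extreme case is [0; 1, s, 1] = (1 + s)/(2 + s). The word [1] has the larger value 1 and
    -- must be excluded; any other single letter gives at most 1/2.
    tail≤ : ∀ {c l} s → Alternating c l → l ≢ [ 1 ] → (∀ {w} → Occurs (suc c) w → w ≤ s) →
      (2 + s) * K⁻ l ≤ (1 + s) * K l
    tail≤ s [] _ _ = subst (_≤ (1 + s) * 1) (sym (*-zeroʳ s)) z≤n
    tail≤ {c} s (_∷_ {w = w} o []) l≢1 _ = begin
      (2 + s) * 1           ≡⟨ *-identityʳ _ ⟩
      2 + s                 ≤⟨ m≤m+n (2 + s) s ⟩
      2 + s + s             ≡⟨ double s ⟩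
      (1 + s) * 2           ≤⟨ *-monoʳ-≤ (1 + s) 2≤w ⟩
      (1 + s) * w           ≡⟨ cong ((1 + s) *_) (trans (+-identityʳ _) (*-identityʳ w)) ⟨
      (1 + s) * (w * 1 + 0) ∎
      where
      open ≤-Reasoning
      double : ∀ s → 2 + s + s ≡ (1 + s) * 2
      double = solve-∀
      2≤w : 2 ≤ w
      2≤w with 2 ≤? w
      ... | yes h = h
      ... | no  h = ⊥-elim (l≢1 (cong [_] (≤-antisym (s≤s⁻¹ (≰⇒> h)) (Occurs-pos {c} o))))
    tail≤ {c} s (_∷_ {w = w} o (_∷_ {w = z} {l = l} o′ os)) _ ≤s = begin
      (2 + s) * (z * K l + K⁻ l)
        ≡⟨ split s (z * K l + K⁻ l) ⟩
      (1 + s) * (z * K l + K⁻ l) + (z * K l + K⁻ l)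
        ≤⟨ +-mono-≤ (*-monoʳ-≤ (1 + s) (m≤n*m (z * K l + K⁻ l) w {{>-nonZero (Occurs-pos {c} o)}}))
             (+-mono-≤ (*-monoˡ-≤ (K l) (≤s o′)) (K⁻≤K (Alternating-pos os))) ⟩
      (1 + s) * (w * (z * K l + K⁻ l)) + (s * K l + K l)
        ≡⟨ join s (w * (z * K l + K⁻ l)) (K l) ⟩
      (1 + s) * (w * (z * K l + K⁻ l) + K l) ∎
      where
      open ≤-Reasoning
      split : ∀ s x → (2 + s) * x ≡ (1 + s) * x + x
      split = solve-∀
      join : ∀ s x y → (1 + s) * x + (s * y + y) ≡ (1 + s) * (x + y)
      join = solve-∀

    -- A first letter at most 2 and a second at least t give at least 1/(2 + 1/t) = t/(1 + 2t); a
    -- single letter gives at least 1/2.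
    tail≥ : ∀ {c l} t → Alternating c l → 0 < K⁻ l →
      (∀ {w} → Occurs c w → w ≤ 2) → (∀ {w} → Occurs (suc c) w → t ≤ w) →
      t * K l ≤ (1 + 2 * t) * K⁻ l
    tail≥ t (_∷_ {w = w} o []) _ ≤2 _ = begin
      t * (w * 1 + 0)     ≤⟨ *-monoʳ-≤ t (+-monoˡ-≤ 0 (*-monoˡ-≤ 1 (≤2 o))) ⟩
      t * 2               ≡⟨ *-comm t 2 ⟩
      2 * t               ≤⟨ n≤1+n _ ⟩
      1 + 2 * t           ≡⟨ *-identityʳ _ ⟨
      (1 + 2 * t) * 1     ∎
      where open ≤-Reasoning
    tail≥ t (_∷_ {w = w} o (_∷_ {w = z} {l = l} o′ os)) _ ≤2 t≤ = begin
      t * (w * y + K l)          ≤⟨ *-monoʳ-≤ t (+-monoˡ-≤ (K l) (*-monoˡ-≤ y (≤2 o))) ⟩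
      t * (2 * y + K l)          ≡⟨ split t y (K l) ⟩
      2 * t * y + t * K l        ≤⟨ +-monoʳ-≤ (2 * t * y) (≤-trans (*-monoˡ-≤ (K l) (t≤ o′)) (m≤m+n (z * K l) _)) ⟩
      2 * t * y + y              ≡⟨ +-comm _ y ⟩
      (1 + 2 * t) * y            ∎
      where
      open ≤-Reasoning
      y = z * K l + K⁻ l
      split : ∀ t y k → t * (2 * y + k) ≡ 2 * t * y + t * k
      split = solve-∀

    -- Letters of equal parity differ by at most 1.

    module Pair {i j} (s : Sides i j) where
      open Sides s public

      Kp>0 : 0 < K p
      Kp>0 = K-pos (Alternating-pos p-alt)
      Kq>0 : 0 < K q
      Kq>0 = K-pos (Alternating-pos q-alt)
      Kr>0 : 0 < K r
      Kr>0 = K-pos (Alternating-pos r-alt)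

      r≤1 : ∀ D → D * K⁻ r ≤ D * K r
      r≤1 D = *-monoʳ-≤ D (K⁻≤K (Alternating-pos r-alt))

      q′≤1 : ∀ D → D * K⁻ q′ ≤ D * K q
      q′≤1 D = *-monoʳ-≤ D (≤-trans (K⁻≤K (Alternating-pos q′-alt)) (≤-reflexive (sym Kq≡Kq′)))

      -- The rejected move: d units leave the letter at i and c units arrive at j. `balanced` says
      -- that the weighted sum is preserved.
      module Move {c d x y} (Wi : W i ≡ x + d) (Wj : W j ≡ y) (x>0 : 0 < x) (c>0 : 0 < c)
                  (balanced : d * wt i ≡ c * wt j) where

        move : F (K p) (K⁻ p) (K q) (K⁻ q′) (K⁻ q) δ (K r) (K⁻ r) x (y + c)
          ≤ F (K p) (K⁻ p) (K q) (K⁻ q′) (K⁻ q) δ (K r) (K⁻ r) (x + d) y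
        move = subst₂ (λ a b → F (K p) (K⁻ p) (K q) (K⁻ q′) (K⁻ q) δ (K r) (K⁻ r) x (y + c)
                  ≤ F (K p) (K⁻ p) (K q) (K⁻ q′) (K⁻ q) δ (K r) (K⁻ r) a b) Wi Wj
          (exchange x (y + c) x>0 (≤-trans c>0 (m≤n+m c y)) (begin
            W i * wt i + W j * wt j           ≡⟨ cong₂ (λ a b → a * wt i + b * wt j) Wi Wj ⟩
            (x + d) * wt i + y * wt j         ≡⟨ split x d (wt i) (y * wt j) ⟩
            x * wt i + (d * wt i + y * wt j)  ≡⟨ cong (λ z → x * wt i + (z + y * wt j)) balanced ⟩
            x * wt i + (c * wt j + y * wt j)  ≡⟨ join x y c (wt i) (wt j) ⟩
            x * wt i + (y + c) * wt j         ∎))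
          where
          open ≡-Reasoning
          split : ∀ x d w z → (x + d) * w + z ≡ x * w + (d * w + z)
          split = solve-∀
          join : ∀ x y c w w′ → x * w + (c * w′ + y * w′) ≡ x * w + (y + c) * w′
          join = solve-∀

        bound : ∀ D {a a′ b b′} → a * K p ≤ D * K⁻ p → a′ * K q ≤ D * K⁻ q →
          D * K⁻ r ≤ b * K r → D * K⁻ q′ ≤ b′ * K q →
          c * (D * x + a + a′) ≤ d * (D * y + b + b′)
        bound D = exchange-bound {K p} {K⁻ p} {K q} {K⁻ q′} {K⁻ q} {δ} {K r} {K⁻ r} c d D Kp>0 Kq>0 Kr>0 move

        bound-strict : ∀ D {b b′} → 0 < D → D * K⁻ r ≤ b * K r → D * K⁻ q′ ≤ b′ * K q →
          c * (D * x) < d * (D * y + b + b′)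
        bound-strict D D>0 = exchange-bound-strict {K p} {K⁻ p} {K q} {K⁻ q′} {K⁻ q} {δ} {K r} {K⁻ r}
          c d D Kp>0 Kq>0 Kr>0 move c>0 D>0 p⁻-pos

    same-weight : ∀ i j → parity i ≡ parity j → 1 * wt i ≡ 1 * wt j
    same-weight i j eq = cong (λ z → 1 * weight z) eq

    -- Since q′ and r are at most 1 and p is positive, moving one unit gives W i - 1 < W j + 2.
    spread≤2 : ∀ {i j} → Inner i → Inner j → parity i ≡ parity j → W i ≤ 2 + W j
    spread≤2 {i} {j} ii ij eq with W i ≤? 2 + W j
    ... | yes h = h
    ... | no  h with x , Wi ← m≤n⇒∃[o]m+o≡n (≰⇒> h) = ⊥-elim (<-irrefl refl (begin-strict
          2 + W j + x            ≡⟨ *-identityˡ _ ⟨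
          1 * (2 + W j + x)      ≡⟨ *-identityˡ _ ⟨
          1 * (1 * (2 + W j + x)) <⟨ M.bound-strict 1 (s≤s z≤n) (P.r≤1 1) (P.q′≤1 1) ⟩
          1 * (1 * W j + 1 + 1)  ≡⟨ simp (W j) ⟩
          2 + W j                ≤⟨ m≤m+n (2 + W j) x ⟩
          2 + W j + x            ∎))
      where
      open ≤-Reasoning
      simp : ∀ y → 1 * (1 * y + 1 + 1) ≡ 2 + y
      simp = solve-∀
      i≢j : i ≢ j
      i≢j refl = h (m≤n+m (W j) 2)
      module P = Pair (sides ii ij i≢j)
      module M = P.Move {1} {1} {2 + W j + x} {W j} (trans (sym Wi) (+-comm 1 _)) refl
        (s≤s z≤n) (s≤s z≤n) (same-weight i j eq)

    -- A fraction q′ or r exceeding 1/2 must start with the letter 1.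
    one-beside : ∀ {i j} → Inner i → Inner j → parity i ≡ parity j → ∀ x → W i ≡ x + 1 → W j < x →
      ∃[ a ] (Inner a × parity a ≡ parity (suc j) × W a ≡ 1)
    one-beside {i} {j} ii ij eq x Wi y<x = go (tail≤1/2 P.q′-alt) (tail≤1/2 P.r-alt)
      where
      i≢j : i ≢ j
      i≢j refl = <-irrefl refl (<-≤-trans y<x (≤-trans (m≤m+n x 1) (≤-reflexive (sym Wi))))
      module P = Pair (sides ii ij i≢j)
      module M = P.Move {1} {1} {x} {W j} Wi refl (≤-<-trans z≤n y<x) (s≤s z≤n) (same-weight i j eq)
      go : ∀ {A : Set} → 2 * K⁻ P.q′ ≤ 1 * K P.q′ ⊎ A → 2 * K⁻ P.r ≤ 1 * K P.r ⊎ A → A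
      go (inj₂ a)  _         = a
      go (inj₁ _)  (inj₂ a)  = a
      go (inj₁ h)  (inj₁ h′) = ⊥-elim (<-irrefl refl (begin-strict
        2 * (1 + W j)         ≤⟨ *-monoʳ-≤ 2 y<x ⟩
        2 * x                 ≡⟨ *-identityˡ _ ⟨
        1 * (2 * x)           <⟨ M.bound-strict 2 (s≤s z≤n) h′ (≤-trans h (*-monoʳ-≤ 1 (≤-reflexive (sym P.Kq≡Kq′)))) ⟩
        1 * (2 * W j + 1 + 1) ≡⟨ simp (W j) ⟩
        2 * (1 + W j)         ∎))
        where
        open ≤-Reasoning
        simp : ∀ y → 1 * (2 * y + 1 + 1) ≡ 2 * (1 + y)
        simp = solve-∀

    excess : ∀ {a b} → ¬ (a ≤ suc b) → ∃[ x ] (a ≡ x + 1 × b < x)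
    excess {suc a} h = a , +-comm 1 a , s≤s⁻¹ (≰⇒> h)
    excess {zero}  h = ⊥-elim (h z≤n)

    even-spread≤1 : ∀ {i j} → Inner i → Inner j → parity i ≡ 0ℙ → parity j ≡ 0ℙ → W i ≤ suc (W j)
    even-spread≤1 {i} {j} ii ij ei ej with W i ≤? suc (W j)
    ... | yes h = h
    ... | no  h
      with x , Wi , y<x ← excess h
      with a , ia , pa , Wa ← one-beside ii ij (trans ei (sym ej)) x Wi y<x
      = ⊥-elim (<-irrefl refl (begin-strict
          3                        <⟨ s≤s (s≤s (s≤s (s≤s z≤n))) ⟩
          -- The letter at i has weight 2 and the 1 at `a` has weight 1, so one unit trades for two.
          -- The bound becomes 2x ≤ 1 + 1 + 1, although x > W j ≥ 1.
          2 * 2                    ≤⟨ *-monoʳ-≤ 2 (≤-<-trans (W-pos (proj₁ ij) (proj₂ ij)) y<x) ⟩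
          2 * x                    ≡⟨ simp x ⟨
          2 * (1 * x + 0 + 0)      ≤⟨ M.bound 1 {0} {0} {1} {1} z≤n z≤n (P.r≤1 1) (P.q′≤1 1) ⟩
          3                        ∎))
      where
      open ≤-Reasoning
      simp : ∀ x → 2 * (1 * x + 0 + 0) ≡ 2 * x
      simp = solve-∀
      odd-a : parity a ≡ 1ℙ
      odd-a = trans pa (trans (parity-suc j) (cong _⁻¹ ej))
      i≢a : i ≢ a
      i≢a refl = 0ℙ≢1ℙ (trans (sym ei) odd-a)
      module P = Pair (sides ii ia i≢a)
      module M = P.Move {2} {1} {x} {1} Wi Wa (≤-<-trans z≤n y<x) (s≤s z≤n)
        (trans (cong (λ e → 1 * weight e) ei) (sym (cong (λ e → 2 * weight e) odd-a)))

    odd-spread≤1 : ∀ {i j} → Inner i → Inner j → parity i ≡ 1ℙ → parity j ≡ 1ℙ → W i ≤ suc (W j)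
    odd-spread≤1 {i} {j} ii ij oi oj with W i ≤? suc (W j)
    ... | yes h = h
    ... | no  h
      with suc x , Wi , s≤s y≤x ← excess h
      with a , ia , pa , Wa ← one-beside ii ij (trans oi (sym oj)) (suc x) Wi (s≤s y≤x)
      = ⊥-elim absurd
      where
      y = W j
      y>0 : 0 < y
      y>0 = W-pos (proj₁ ij) (proj₂ ij)
      even-a : parity a ≡ 0ℙ
      even-a = trans pa (trans (parity-suc j) (cong _⁻¹ oj))

      -- Now W i = x + 2 is odd-placed and the 1 at `a` is even-placed, so two units trade for one,
      -- and x < 2 (1 + 1 + 1).
      x≤5 : x ≤ 5
      x≤5 = s≤s⁻¹ (subst (_< 6) (simp x) (M.bound-strict 1 {1} {1} (s≤s z≤n) (P.r≤1 1) (P.q′≤1 1)))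
        where
        shift : ∀ x → suc x + 1 ≡ x + 2
        shift = solve-∀
        simp : ∀ x → 1 * (1 * x) ≡ x
        simp = solve-∀
        i≢a : i ≢ a
        i≢a refl = 0ℙ≢1ℙ (trans (sym even-a) oi)
        module P = Pair (sides ii ia i≢a)
        module M = P.Move {1} {2} {x} {1} (trans Wi (shift x)) Wa (≤-trans y>0 y≤x) (s≤s z≤n)
          (trans (cong (λ e → 2 * weight e) oi) (sym (cong (λ e → 1 * weight e) even-a)))

      i≢j : i ≢ j
      i≢j refl = h (n≤1+n _)
      module P = Pair (sides ii ij i≢j)
      module M = P.Move {1} {1} {suc x} {y} Wi refl (s≤s z≤n) (s≤s z≤n) (same-weight i j (trans oi (sym oj)))

      q⁻>0 : 0 < K⁻ P.q
      q⁻>0 = P.q⁻-pos (trans oi (sym oj))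

      -- The even case is already settled, so no even letter exceeds the 1 at `a` by more than 1.
      even≤2 : ∀ {k w} → parity k ≡ 1ℙ → Occurs (suc k) w → w ≤ 2
      even≤2 _ (inj₁ refl) = ≤-refl
      even≤2 {k} ok (inj₂ (b , ib , pb , refl)) = subst (λ z → W b ≤ suc z) Wa
        (even-spread≤1 ib ia (trans pb (trans (parity-suc k) (cong _⁻¹ ok))) even-a)

      odd≤ : ∀ {k w} → parity k ≡ 1ℙ → Occurs k w → w ≤ 2 + y
      odd≤ _ (inj₁ refl) = s≤s (s≤s z≤n)
      odd≤ ok (inj₂ (b , ib , pb , refl)) = spread≤2 ib ij (trans pb (trans ok (sym oj)))

      -- The minimum with 2 admits the pins. For an inner letter, `spread≤2` applied from i gives W
      -- b ≥ W i - 2 = x ≥ y.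
      odd≥ : ∀ {k w} → parity k ≡ 1ℙ → Occurs k w → 2 ⊓ y ≤ w
      odd≥ _ (inj₁ refl) = m⊓n≤m 2 y
      odd≥ ok (inj₂ (b , ib , pb , refl)) = ≤-trans (m⊓n≤n 2 y) (≤-trans y≤x
        (s≤s⁻¹ (s≤s⁻¹ (≤-trans (≤-reflexive (trans (+-comm 1 (suc x)) (sym Wi)))
        (spread≤2 ii ib (trans oi (sym (trans pb ok))))))))

      -- If q′ = [1] then q = [1] as well, and the two middle fractions cancel. With r ≤ 1 this
      -- leaves x + p ≤ y, against p > 0 and y ≤ x. Taking K p as the denominator keeps p exact.
      q′≢1 : P.q′ ≢ [ 1 ]
      q′≢1 q′≡1 = <-irrefl refl (begin-strict
        1 * (k * y + k + k)                   ≡⟨ simp k y ⟩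
        k * suc y + 0 + k                     <⟨ +-monoˡ-< k (+-monoʳ-< (k * suc y) P.p⁻-pos) ⟩
        k * suc y + K⁻ P.p + k                ≤⟨ +-monoˡ-≤ k (+-monoˡ-≤ (K⁻ P.p) (*-monoʳ-≤ k (s≤s y≤x))) ⟩
        k * suc x + K⁻ P.p + k                ≡⟨ *-identityˡ _ ⟨
        1 * (k * suc x + K⁻ P.p + k)          ≤⟨ M.bound k (≤-reflexive (*-comm (K⁻ P.p) k))
                                                  (subst (λ l → k * K l ≤ k * K⁻ l) (sym (P.q-single q′≡1)) ≤-refl)
                                                  (P.r≤1 k) (P.q′≤1 k) ⟩
        1 * (k * y + k + k)                   ∎)
        where
        open ≤-Reasoning
        k = K P.p
        simp : ∀ k y → 1 * (k * y + k + k) ≡ k * suc y + 0 + k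
        simp = solve-∀

      r≢1 : P.r ≢ [ 1 ]
      r≢1 r≡1 with () ← P.r-end r≡1

      -- This is 1 + 2t/(1 + 2t) ≤ 2(1 + s)/(2 + s), cleared of denominators: p and q are bounded
      -- below by `tail≥`, q′ and r above by `tail≤`.
      refute : ∀ s t → 2 + y ≤ s → t ≤ 2 ⊓ y →
        (1 + 2 * t) * (2 + s) + (2 + s) * t + (2 + s) * t ≤ (1 + 2 * t) * (1 + s) + (1 + 2 * t) * (1 + s)
      refute s t y≤s t≤y = +-cancelˡ-≤ (D * y) _ _ (begin
        D * y + (D + lo + lo)             ≡⟨ left D y lo ⟩
        1 * (D * suc y + lo + lo)       ≤⟨ *-monoʳ-≤ 1 (+-monoˡ-≤ lo (+-monoˡ-≤ lo (*-monoʳ-≤ D (s≤s y≤x)))) ⟩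
        1 * (D * suc x + lo + lo)       ≤⟨ M.bound D (lower P.p-alt P.p⁻-pos) (lower P.q-alt q⁻>0)
                                            (upper P.r-alt r≢1)
                                            (≤-trans (upper P.q′-alt q′≢1) (*-monoʳ-≤ hi (≤-reflexive (sym P.Kq≡Kq′)))) ⟩
        1 * (D * y + hi + hi)           ≡⟨ right (D * y) hi ⟩
        D * y + (hi + hi)               ∎)
        where
        open ≤-Reasoning
        D = (1 + 2 * t) * (2 + s)
        lo = (2 + s) * t
        hi = (1 + 2 * t) * (1 + s)
        left : ∀ D y c → D * y + (D + c + c) ≡ 1 * (D * suc y + c + c)
        left = solve-∀
        right : ∀ x b → 1 * (x + b + b) ≡ x + (b + b)
        right = solve-∀
        upper : ∀ {l} → Alternating (suc j) l → l ≢ [ 1 ] → D * K⁻ l ≤ hi * K l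
        upper {l} alt l≢1 = *-scaleˡ-≤ {2 + s} {1 + s} {K⁻ l} {K l} (1 + 2 * t)
          (tail≤ s alt l≢1 λ o → ≤-trans (odd≤ {2 + j} oj o) y≤s)
        lower : ∀ {l} → Alternating (suc i) l → 0 < K⁻ l → lo * K l ≤ D * K⁻ l
        lower {l} alt l⁻>0 = subst (λ D → lo * K l ≤ D * K⁻ l) (*-comm (2 + s) (1 + 2 * t))
          (*-scaleˡ-≤ {t} {1 + 2 * t} {K l} {K⁻ l} (2 + s)
            (tail≥ t alt l⁻>0 (even≤2 {i} oi) λ o → ≤-trans t≤y (odd≥ {2 + i} oi o)))

      absurd : ⊥
      absurd with 2 ≤? y
      -- From y ≤ 5 come s = 7 and t = 2, and 9/5 ≤ 16/9 fails. In the other case y = 1 gives s = 3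
      -- and t = 1, and 5/3 ≤ 8/5 fails.
      ... | yes 2≤y = ≤⇒≤ᵇ (refute 7 2 (+-monoʳ-≤ 2 (≤-trans y≤x x≤5)) (≤-reflexive (sym (m≤n⇒m⊓n≡m 2≤y))))
      ... | no  2≰y = ≤⇒≤ᵇ (refute 3 1 (+-monoʳ-≤ 2 (s≤s⁻¹ (≰⇒> 2≰y))) (⊓-glb (s≤s z≤n) y>0))

  -- From vectors to pinned words.

  -- Reading past the end gives the right-hand pin.
  entry : ∀ {n} → Vec ℕ n → ℕ → ℕ
  entry []      _       = 2
  entry (a ∷ A) zero    = a
  entry (a ∷ A) (suc k) = entry A k

  entry-end : ∀ {n} (A : Vec ℕ n) → entry A n ≡ 2
  entry-end []      = refl
  entry-end (a ∷ A) = entry-end A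

  entry-toℕ : ∀ {n} (A : Vec ℕ n) i → entry A (toℕ i) ≡ lookup A i
  entry-toℕ (a ∷ A) zero    = refl
  entry-toℕ (a ∷ A) (suc i) = entry-toℕ A i

  entry-pos : ∀ {n k} {A : Vec ℕ n} → VAll.All (0 <_) A → 0 < entry A k
  entry-pos []                     = s≤s z≤n
  entry-pos {k = zero}  (0<a ∷ _)  = 0<a
  entry-pos {k = suc k} (_ ∷ ps)   = entry-pos {k = k} ps

  up-suc : ∀ f k m → up f (suc k) m ≡ up (f ∘ suc) k m
  up-suc f k zero    = refl
  up-suc f k (suc m) = cong (f (suc k) ∷_) (up-suc f (suc k) m)

  up-entry : ∀ {n} (A : Vec ℕ n) → up (entry A) 0 n ≡ toList A
  up-entry []      = refl
  up-entry {suc n} (a ∷ A) = cong (a ∷_) (trans (up-suc (entry (a ∷ A)) 0 n) (up-entry A))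

  Sφ≡wsum : ∀ {n} (A : Vec ℕ n) → Sφ A ≡ wsum 1 (toList A)
  Sφ≡wsum = from 1
    where
    from : ∀ {n} k (A : Vec ℕ n) → sum (tabulate λ i → lookup A i * wt (k + toℕ i)) ≡ wsum k (toList A)
    from k []      = refl
    from k (a ∷ A) = cong₂ _+_ (cong (λ z → a * wt z) (+-identityʳ k))
      (trans (cong sum (tabulate-cong λ i → cong (λ z → lookup A i * wt z) (+-suc k (toℕ i)))) (from (suc k) A))

  fromList-length : ∀ {n} (L : List ℕ) → length L ≡ n → ∃[ A ] toList {n = n} A ≡ L
  fromList-length L refl = fromList L , toList∘fromList L

  pinned : ∀ {n} → Vec ℕ n → ℕ
  pinned A = K (2 ∷ toList A ++ [ 2 ])

  K⁻-reverse≤ : ∀ {l} → All (0 <_) l → K⁻ (reverse l) ≤ K l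
  K⁻-reverse≤ {l} ps = subst (K⁻ (reverse l) ≤_) (K-reverse l) (K⁻≤K (All-resp-↭ (↭-sym (↭-reverse l)) ps))

  -- Each pin at least doubles the continuant: the term with `K⁻` is dropped twice.
  pinned-≥ : ∀ {n} (A : Vec ℕ n) → 4 * continuant A ≤ pinned A
  pinned-≥ A = begin
    4 * continuant A              ≡⟨ cong (4 *_) (continuant≡K A) ⟩
    4 * K l                       ≡⟨ *-assoc 2 2 (K l) ⟩
    2 * (2 * K l)                 ≤⟨ *-monoʳ-≤ 2 (m≤m+n (2 * K l) _) ⟩
    2 * (2 * K l + K⁻ (reverse l)) ≡⟨ cong (2 *_) (K-∷ʳ l 2) ⟨
    2 * K (l ++ [ 2 ])            ≤⟨ m≤m+n _ _ ⟩
    pinned A                      ∎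
    where
    open ≤-Reasoning
    l = toList A

  -- Each pin at most triples the continuant, since `K⁻` is at most `K` on positive letters.
  pinned-≤ : ∀ {n} {A : Vec ℕ n} → VAll.All (0 <_) A → pinned A ≤ 9 * continuant A
  pinned-≤ {A = A} ps = begin
    2 * K (l ++ [ 2 ]) + K⁻ (l ++ [ 2 ])  ≤⟨ +-monoʳ-≤ (2 * K (l ++ [ 2 ])) (K⁻≤K (++⁺ (toList⁺ ps) (s≤s z≤n ∷ []))) ⟩
    2 * K (l ++ [ 2 ]) + K (l ++ [ 2 ])   ≡⟨ three (K (l ++ [ 2 ])) ⟩
    3 * K (l ++ [ 2 ])                    ≡⟨ cong (3 *_) (K-∷ʳ l 2) ⟩
    3 * (2 * K l + K⁻ (reverse l))        ≤⟨ *-monoʳ-≤ 3 (+-monoʳ-≤ (2 * K l) (K⁻-reverse≤ (toList⁺ ps))) ⟩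
    3 * (2 * K l + K l)                   ≡⟨ nine (K l) ⟩
    9 * K l                               ≡⟨ cong (9 *_) (continuant≡K A) ⟨
    9 * continuant A                      ∎
    where
    open ≤-Reasoning
    l = toList A
    three : ∀ x → 2 * x + x ≡ 3 * x
    three = solve-∀
    nine : ∀ x → 3 * (2 * x + x) ≡ 9 * x
    nine = solve-∀

  -- The condition of `M₄` with a and b eliminated. Only finitely many comparisons remain, which
  -- makes `M₄` decidable.
  Balanced : ∀ {n} → Vec ℕ n → Set
  Balanced A = ∀ i j → indexParity i ≡ indexParity j → lookup A i ≤ suc (lookup A j)

  IsArgmax : ∀ {n} → Pred (Vec ℕ n) 0ℓ → (Vec ℕ n → ℕ) → Vec ℕ n → Set
  IsArgmax P f A = P A × (∀ A′ → P A′ → f A′ ≤ f A)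

  pinned-argmax-balanced : ∀ {n S} {A : Vec ℕ n} → IsArgmax (M n S) pinned A → Balanced A
  pinned-argmax-balanced {n} {S} {A} ((A>0 , SA) , max) i j eq =
    subst₂ (λ a b → a ≤ suc b) (entry-toℕ A i) (entry-toℕ A j) (spread (parity (suc (toℕ i))) refl)
    where
    W : ℕ → ℕ
    -- The left pin is prepended and the right pin is the default value of `entry`, so `A` occupies
    -- positions 1 to n.
    W = entry (2 ∷ A)

    up≡ : up W 1 n ≡ toList A
    up≡ = trans (up-suc W 0 n) (up-entry A)

    W-max : ∀ L → length L ≡ n → All (0 <_) L → wsum 1 L ≡ wsum 1 (up W 1 n) →
      K (2 ∷ L ++ [ 2 ]) ≤ K (2 ∷ up W 1 n ++ [ 2 ])
    W-max L len ps weq with A′ , refl ← fromList-length L len =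
      subst (λ l → pinned A′ ≤ K (2 ∷ l ++ [ 2 ])) (sym up≡)
        (max A′ (toList⁻ ps , trans (Sφ≡wsum A′) (trans weq (trans (cong (wsum 1) up≡) (trans (sym (Sφ≡wsum A)) SA)))))

    open Exchange n W refl (entry-end A) (λ {k} _ _ → entry-pos {k = k} (s≤s z≤n ∷ A>0)) W-max

    inner : ∀ (i : Fin n) → Inner (suc (toℕ i))
    inner i = s≤s z≤n , toℕ<n i

    spread : ∀ c → parity (suc (toℕ i)) ≡ c → W (suc (toℕ i)) ≤ suc (W (suc (toℕ j)))
    spread 0ℙ e = even-spread≤1 (inner i) (inner j) e (trans (sym eq) e)
    spread 1ℙ e = odd-spread≤1 (inner i) (inner j) e (trans (sym eq) e)

  -- The balanced form of `M₄`.

  -- The least value in the parity class serves as a. Given one entry of the class, the least is one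
  -- below it if such an entry occurs, and that entry itself otherwise. An empty class, such as the
  -- even positions for n = 1, accepts any positive a.
  two-values : ∀ {n} {A : Vec ℕ n} → VAll.All (0 <_) A → Balanced A → ∀ c →
    ∃[ a ] (0 < a × (∀ i → indexParity i ≡ c → lookup A i ≡ a ⊎ lookup A i ≡ suc a))
  two-values {n} {A} A>0 bal c with any? (λ i → indexParity {n} i ℙ.≟ c)
  ... | no  none = 1 , s≤s z≤n , λ i pi → ⊥-elim (none (i , pi))
  ... | yes (i₀ , p₀) with any? (λ j → indexParity j ℙ.≟ c ×-dec suc (lookup A j) ≟ lookup A i₀)
  ...   | yes (j , pj , eq) = lookup A j , lookup⁺ A>0 j , λ i pi →
          ≤∧≤suc (s≤s⁻¹ (subst (_≤ suc (lookup A i)) (sym eq) (bal i₀ i (trans p₀ (sym pi)))))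
            (bal i j (trans pi (sym pj)))
    where
    ≤∧≤suc : ∀ {a b} → a ≤ b → b ≤ suc a → b ≡ a ⊎ b ≡ suc a
    ≤∧≤suc a≤b b≤ with m≤n⇒m<n∨m≡n b≤
    ... | inj₁ (s≤s b≤a) = inj₁ (≤-antisym b≤a a≤b)
    ... | inj₂ e         = inj₂ e
  ...   | no  none = lookup A i₀ , lookup⁺ A>0 i₀ , λ i pi →
          close i pi (m≤n⇒m<n∨m≡n (bal i i₀ (trans pi (sym p₀)))) (m≤n⇒m<n∨m≡n (bal i₀ i (trans p₀ (sym pi))))
    where
    close : ∀ i → indexParity i ≡ c →
      lookup A i < suc (lookup A i₀) ⊎ lookup A i ≡ suc (lookup A i₀) →
      lookup A i₀ < suc (lookup A i) ⊎ lookup A i₀ ≡ suc (lookup A i) →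
      lookup A i ≡ lookup A i₀ ⊎ lookup A i ≡ suc (lookup A i₀)
    close i pi (inj₂ e)  _         = inj₂ e
    close i pi (inj₁ _)  (inj₂ e)  = ⊥-elim (none (i , pi , sym e))
    close i pi (inj₁ (s≤s h)) (inj₁ (s≤s h′)) = inj₁ (≤-antisym h h′)

  balanced⇒M₄ : ∀ {n S} {A : Vec ℕ n} → M n S A × Balanced A → M₄ n S A
  balanced⇒M₄ (m@(A>0 , _) , bal)
    with a , a>0 , as ← two-values A>0 bal 1ℙ
    with b , b>0 , bs ← two-values A>0 bal 0ℙ
    = m , a , b , a>0 , b>0 , as , bs

  M₄⇒balanced : ∀ {n S} {A : Vec ℕ n} → M₄ n S A → M n S A × Balanced A
  M₄⇒balanced {A = A} (m , a , b , _ , _ , as , bs) = m , balanced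
    where
    close : ∀ {a x y} → x ≡ a ⊎ x ≡ suc a → y ≡ a ⊎ y ≡ suc a → x ≤ suc y
    close (inj₁ refl) (inj₁ refl) = n≤1+n _
    close (inj₁ refl) (inj₂ refl) = ≤-trans (n≤1+n _) (n≤1+n _)
    close (inj₂ refl) (inj₁ refl) = ≤-refl
    close (inj₂ refl) (inj₂ refl) = n≤1+n _
    balanced : Balanced A
    balanced i j eq with indexParity i in pi
    ... | 1ℙ = close (as i pi) (as j (sym eq))
    ... | 0ℙ = close (bs i pi) (bs j (sym eq))

  -- Existence of the maxima and their comparison.

  M? : ∀ n S → Decidable (M n S)
  M? n S A = VAll.all? (0 <?_) A ×-dec Sφ A ≟ S

  M₄? : ∀ n S → Decidable (M₄ n S)
  M₄? n S A = map′ balanced⇒M₄ M₄⇒balanced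
    (M? n S A ×-dec all? λ i → all? λ j → indexParity i ℙ.≟ indexParity j →-dec lookup A i ≤? suc (lookup A j))

  boundedVecs : ∀ n → ℕ → List (Vec ℕ n)
  boundedVecs zero    B = [ [] ]
  boundedVecs (suc n) B = cartesianProductWith _∷_ (upTo (suc B)) (boundedVecs n B)

  ∈-boundedVecs : ∀ {n B} {A : Vec ℕ n} → VAll.All (_≤ B) A → A ∈ boundedVecs n B
  ∈-boundedVecs []         = here refl
  ∈-boundedVecs (a≤B ∷ ps) = ∈-cartesianProductWith⁺ _∷_ (∈-upTo⁺ (s≤s a≤B)) (∈-boundedVecs ps)

  -- The bound B confines P to a finite list that can be searched; the given element of P is the
  -- initial candidate.
  ∃-argmax : ∀ {n} {P : Pred (Vec ℕ n) 0ℓ} B (f : Vec ℕ n → ℕ) → Decidable P →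
    (∀ {A} → P A → VAll.All (_≤ B) A) → Satisfiable P → ∃[ A ] IsArgmax P f A
  ∃-argmax {n} {P} B f P? P≤B (A₀ , pA₀) =
    argmax f A₀ candidates , argmax-all f pA₀ (all-filter P? (boundedVecs n B)) ,
    λ A pA → All.lookup (f[xs]≤f[argmax] A₀ candidates) (∈-filter⁺ P? (∈-boundedVecs (P≤B pA)) pA)
    where
    candidates = filter P? (boundedVecs n B)

  -- All weights are at least 1, so no entry exceeds the weighted sum.
  M-bounded : ∀ {n S} {A : Vec ℕ n} → M n S A → VAll.All (_≤ S) A
  M-bounded {A = A} (_ , SA) = toList⁻ (entries≤wsum 1 (toList A) (≤-reflexive (trans (sym (Sφ≡wsum A)) SA)))
    where
    1≤wt : ∀ c → 1 ≤ weight c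
    1≤wt 0ℙ = s≤s z≤n
    1≤wt 1ℙ = s≤s z≤n
    entries≤wsum : ∀ {S} k l → wsum k l ≤ S → All (_≤ S) l
    entries≤wsum k []      _ = []
    entries≤wsum k (a ∷ l) h =
      ≤-trans (≤-trans (m≤m*n a (wt k) {{>-nonZero (1≤wt (parity k))}}) (m≤m+n (a * wt k) _)) h
      ∷ entries≤wsum (suc k) l (≤-trans (m≤n+m _ (a * wt k)) h)

  -- A maximises ⟨A⟩ over M, B maximises ⟨2,B,2⟩ over M, and C maximises ⟨C⟩ over M₄. That B lies in
  -- M₄ both provides C and links the chain from A to C.
  ∃-maxima : ∀ n S → Satisfiable (M n S) → ∃[ m ] ∃[ m₄ ]
    (IsMaxContinuant (M n S) m × IsMaxContinuant (M₄ n S) m₄ × 0 < m₄ × m₄ ≤ m × 4 * m ≤ 9 * m₄)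
  ∃-maxima n S sat
    with A , mA , maxA ← ∃-argmax S continuant (M? n S) M-bounded sat
    with B , mB , maxB ← ∃-argmax S pinned (M? n S) M-bounded sat
    with m₄B ← balanced⇒M₄ (mB , pinned-argmax-balanced (mB , maxB))
    with C , m₄C , maxC ← ∃-argmax S continuant (M₄? n S) (M-bounded ∘ proj₁) (B , m₄B)
    = continuant A , continuant C , ((A , mA , refl) , maxA) , ((C , m₄C , refl) , maxC) ,
      subst (0 <_) (sym (continuant≡K C)) (K-pos (toList⁺ (proj₁ (proj₁ m₄C)))) ,
      maxA C (proj₁ m₄C) ,
      (begin
        4 * continuant A  ≤⟨ pinned-≥ A ⟩
        pinned A          ≤⟨ maxB A mA ⟩
        pinned B          ≤⟨ pinned-≤ (proj₁ mB) ⟩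
        9 * continuant B  ≤⟨ *-monoʳ-≤ 9 (maxC B m₄B) ⟩
        9 * continuant C  ∎)
    where open ≤-Reasoning

  -- The ratio as a rational number.

  -- Normalised quotients are compared through unnormalised ones, whose order is
  -- cross-multiplication by definition.
  /-mono-≤ : ∀ {a b c d} → a * suc d ≤ c * suc b → ℤ.+ a ℚ./ suc b ℚ.≤ ℤ.+ c ℚ./ suc d
  /-mono-≤ {a} {b} {c} {d} h = ℚ.toℚᵘ-cancel-≤
    (ℚᵘ.≤-respˡ-≃ (ℚᵘ.≃-sym (ℚ.toℚᵘ-fromℚᵘ (mkℚᵘ (ℤ.+ a) b)))
      (ℚᵘ.≤-respʳ-≃ (ℚᵘ.≃-sym (ℚ.toℚᵘ-fromℚᵘ (mkℚᵘ (ℤ.+ c) d)))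
        (*≤* (subst₂ ℤ._≤_ (ℤ.pos-* a (suc d)) (ℤ.pos-* c (suc b)) (ℤ.+≤+ h)))))

  ratio-bounds : ∀ {m m₄} → (m₄>0 : 0 < m₄) → m₄ ≤ m → 4 * m ≤ 9 * m₄ →
    (ℤ.+ 1 ℚ./ 1 ℚ.≤ ℚ._/_ (ℤ.+ m) m₄ {{>-nonZero m₄>0}}) ×
    (ℚ._/_ (ℤ.+ m) m₄ {{>-nonZero m₄>0}} ℚ.≤ ℤ.+ 9 ℚ./ 4)
  ratio-bounds {m} {suc k} (s≤s _) m₄≤m 4m≤9m₄ =
    /-mono-≤ {1} {0} {m} {k} (subst₂ _≤_ (sym (*-identityˡ (suc k))) (sym (*-identityʳ m)) m₄≤m) ,
    /-mono-≤ {m} {k} {9} {3} (subst (_≤ 9 * suc k) (*-comm 4 m) 4m≤9m₄)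

open PinnedContinuant using (∃-maxima; ratio-bounds)
open import Data.Nat.Base using (ℕ; NonZero; >-nonZero) renaming (_<_ to _<ℕ_)
open import Data.Integer.Base using (+_)
open import Data.Product.Base using (Σ-syntax; ∃-syntax; _×_; _,_)
open import Data.Rational.Base using (ℚ; 0ℚ; _/_; _≤_; _<_)
open import Data.Rational.Properties using (positive⁻¹)
open import Relation.Unary using (Satisfiable)

theorem1 : ∃[ c₁ ] ∃[ c₂ ] (0ℚ < c₁ × 0ℚ < c₂ ×
    (∀ (n S : ℕ) → 0 <ℕ n → 0 <ℕ S → Satisfiable (M n S) →
    ∃[ m ] ∃[ m₄ ] (IsMaxContinuant (M n S) m × IsMaxContinuant (M₄ n S) m₄ ×
    (Σ[ m₄≢0 ∈ NonZero m₄ ]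
    (c₁ ≤ _/_ (+ m) m₄ {{m₄≢0}} × _/_ (+ m) m₄ {{m₄≢0}} ≤ c₂)))))
-- The lower constant 1 comes from the inclusion of M₄ in M, the upper constant 9/4 from the factors
-- 9 and 4 of the two pins.
theorem1 = + 1 / 1 , + 9 / 4 , positive⁻¹ (+ 1 / 1) , positive⁻¹ (+ 9 / 4) , λ n S _ _ sat →
  let m , m₄ , max , max₄ , m₄>0 , m₄≤m , 4m≤9m₄ = ∃-maxima n S sat
  in m , m₄ , max , max₄ , >-nonZero m₄>0 , ratio-bounds m₄>0 m₄≤m 4m≤9m₄
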